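{- Catch leafage is not bounded by any function of leafage. If $F_n$ denotes the $n$-vertex digraph whose adjacency matrix is $$\begin{pmatrix} I & Y\\ Y^T & 1\end{pmatrix},$$ where $I$ denotes the $(n-1)\times(n-1)$ identity matrix and $Y$ denotes the column vector of $n-1$ ones, then $f^*(F_n)=l(F_n)=2$, but $l^*(F_n)=n-1$.
   Context: A digraph $D$ is finite with vertex set $V(D)$, and is identified with a relation $D\subseteq V(D)\times V(D)$ (its set of edges; loops are allowed, no multiple edges). Its adjacency matrix has entry $1$ in position $(u,v)$ if $uv$ is an edge and $0$ otherwise. $\overline{D}=(V(D)\times V(D))\setminus D$ is its complement. Trees are finite; a leaf is a vertex of degree 1. Subtrees are nonempty connected subgraphs. A subtree representation of $D$ in a host tree $T$ assigns to each vertex $v$ an ordered pair $(S_v,T_v)$ of subtrees of $T$ (source subtree and sink subtree) such that $uv$ is an edge of $D$ if and only if $S_u$ and $T_v$ have a common vertex (for all $u,v\in V(D)$, including $u=v$). The leafage $l(D)$ is the minimum number of leaves of a host tree in which $D$ has a subtree representation. The catch leafage $l^*(D)$ is the minimum number of leaves of a host tree in which $D$ has a subtree representation where every sink subtree $T_v$ is a single vertex. A digraph is a Ferrers digraph if its successor sets $\{u: vu\in E\}$, over all vertices $v$, are linearly ordered by inclusion; equivalently, its adjacency matrix has no $2\times 2$ permutation submatrix (two rows and two columns, not necessarily consecutive). $f^*(D)$ is the minimum number of pairwise disjoint Ferrers digraphs on $V(D)$ (as edge sets) whose union is $\overline{D}$.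
   Formalization: The values for F_n are stated for n ≥ 3: for n ≤ 2 the adjacency matrix is all ones, so the complement is empty and a one-vertex host tree (no leaves) works, giving f* = l = l* = 0 and not f* = l = 2. -}

module Defs where

open import Data.Bool.Base using (Bool; true; false; T; not)
open import Data.Fin.Base using (Fin)
open import Data.Fin.Properties using (_≟_)
open import Data.Fin.Relation.Unary.Top using (View; view; ‵fromℕ; ‵inject₁)
open import Data.Fin.Subset using (Subset; _∈_; _∩_; Nonempty; ∣_∣; ⁅_⁆)
open import Data.List.Base using (List; _∷_; _++_; [_]; length)
open import Data.List.Relation.Unary.Linked using (Linked)
open import Data.List.Relation.Unary.Unique.Propositional using (Unique)
open import Data.Nat.Base using (ℕ; _≤_; NonZero)
import Data.Nat.Properties as ℕ
open import Data.Product.Base using (Σ-syntax; ∃; _×_)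
open import Data.Sum.Base using (_⊎_)
open import Data.Vec.Base using (tabulate)
open import Function.Bundles using (_⇔_)
open import Relation.Binary.Construct.Closure.ReflexiveTransitive using (Star)
open import Relation.Binary.PropositionalEquality.Core using (_≡_; _≢_)
open import Relation.Nullary using (¬_; does)
open import Relation.Unary using (_⊆_)

-- The minimum of a set of natural numbers, as a relation.

IsMinimum : (ℕ → Set) → ℕ → Set
IsMinimum P k = P k × (∀ j → P j → k ≤ j)

------------------------------------------------------------------------
-- Digraphs

-- A digraph on the vertex set Fin n, given by its adjacency matrix
-- (true is 1, false is 0).  The row is the tail of the edge.

Digraph : ℕ → Set
Digraph n = Fin n → Fin n → Bool

Edge : ∀ {n} → Digraph n → Fin n → Fin n → Set
Edge D u v = T (D u v)

complement : ∀ {n} → Digraph n → Digraph n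
complement D u v = not (D u v)

-- Edge D u is the successor set of u.

Ferrers : ∀ {n} → Digraph n → Set
Ferrers D = ∀ u v → (Edge D u ⊆ Edge D v) ⊎ (Edge D v ⊆ Edge D u)

record FerrersPartition {n} (D : Digraph n) (k : ℕ) : Set where
  field
    part     : Fin k → Digraph n
    ferrers  : ∀ i → Ferrers (part i)
    disjoint : ∀ i j → i ≢ j → ∀ u v → ¬ (Edge (part i) u v × Edge (part j) u v)
    union    : ∀ u v → Edge D u v ⇔ ∃ λ i → Edge (part i) u v

-- IsFStar D k  says  f*(D) = k.

IsFStar : ∀ {n} → Digraph n → ℕ → Set
IsFStar D = IsMinimum (FerrersPartition (complement D))

-- F n is the digraph with adjacency matrix
--
--   ( I  Y )
--   ( Yᵀ 1 )
--
-- where the last block row and column have size 1.  The view of a vertex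
-- tells whether it is the last one or lies in the first n - 1.

block : ∀ {n} {u v : Fin n} → View u → View v → Bool
block (‵inject₁ i) (‵inject₁ j) = does (i ≟ j)
block (‵inject₁ _) ‵fromℕ       = true
block ‵fromℕ       (‵inject₁ _) = true
block ‵fromℕ       ‵fromℕ       = true

F : (n : ℕ) → Digraph n
F n u v = block (view u) (view v)

------------------------------------------------------------------------
-- Trees

record Graph (m : ℕ) : Set where
  field
    adj         : Fin m → Fin m → Bool
    symmetric   : ∀ u v → T (adj u v) → T (adj v u)
    irreflexive : ∀ u → ¬ T (adj u u)

  Adj : Fin m → Fin m → Set
  Adj u v = T (adj u v)

  degree : Fin m → ℕ
  degree v = ∣ tabulate (adj v) ∣

  leaves : Subset m
  leaves = tabulate λ v → does (degree v ℕ.≟ 1)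

  -- x , xs lists the vertices of a cycle in order, starting from x.

  IsCycle : Fin m → List (Fin m) → Set
  IsCycle x xs = 2 ≤ length xs × Unique (x ∷ xs) × Linked Adj (x ∷ xs ++ [ x ])

  Connected : Set
  Connected = ∀ u v → Star Adj u v

  Acyclic : Set
  Acyclic = ∀ x xs → ¬ IsCycle x xs

record Tree : Set where
  field
    order     : ℕ
    nonempty  : NonZero order
    graph     : Graph order
    connected : Graph.Connected graph
    acyclic   : Graph.Acyclic graph

  open Graph graph public using (adj; Adj; leaves)

  Vertex : Set
  Vertex = Fin order

  leafCount : ℕ
  leafCount = ∣ leaves ∣

record Subtree (H : Tree) : Set where
  open Tree H using (order; Vertex; Adj)
  field
    vertices  : Subset order
    edges     : Vertex → Vertex → Bool
    symmetric : ∀ x y → T (edges x y) → T (edges y x)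
    ends      : ∀ x y → T (edges x y) → x ∈ vertices × y ∈ vertices
    subgraph  : ∀ x y → T (edges x y) → Adj x y
    nonempty  : Nonempty vertices
    connected : ∀ x y → x ∈ vertices → y ∈ vertices → Star (λ a b → T (edges a b)) x y

open Subtree using (vertices)

------------------------------------------------------------------------
-- Subtree representations and leafage

record Representation {n} (D : Digraph n) (H : Tree) : Set where
  field
    source : Fin n → Subtree H
    sink   : Fin n → Subtree H
    edge⇔  : ∀ u v → Edge D u v ⇔ Nonempty (vertices (source u) ∩ vertices (sink v))

IsPoint : ∀ {H} → Subtree H → Set
IsPoint S = ∃ λ x → vertices S ≡ ⁅ x ⁆

IsCatch : ∀ {n} {D : Digraph n} {H} → Representation D H → Set
IsCatch R = ∀ v → IsPoint (Representation.sink R v)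

-- IsLeafage D k  says  l(D) = k,  and  IsCatchLeafage D k  says  l*(D) = k.

IsLeafage : ∀ {n} → Digraph n → ℕ → Set
IsLeafage D = IsMinimum λ k →
  Σ[ H ∈ Tree ] Tree.leafCount H ≡ k × Representation D H

IsCatchLeafage : ∀ {n} → Digraph n → ℕ → Set
IsCatchLeafage D = IsMinimum λ k →
  Σ[ H ∈ Tree ] Tree.leafCount H ≡ k × Σ[ R ∈ Representation D H ] IsCatch R

{-# OPTIONS --safe #-}

-- Two Ferrers digraphs suffice for the complement of F n: the entries above the
-- diagonal and those below it.  A path on n - 1 vertices represents F n, vertex i
-- being given by the point i and the last vertex by the whole path.  For the catch
-- leafage, the star with n - 1 leaves serves as host.  Conversely, in a host tree let
-- the last sink be the vertex c and the i-th sink the vertex t i.  The i-th source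
-- subtree joins c to t i and misses every other t j, so no t j separates c from t i,
-- and the leaves found by walking on from c through each t i are distinct.
module Submission where

open import Defs
open import Data.Bool.Base using (Bool; true; false; T; not; _∨_)
open import Data.Bool.Properties using (T?; T-≡; T-∨)
open import Data.Fin.Base as Fin using (Fin; zero; suc; toℕ; fromℕ; inject₁)
open import Data.Fin.Properties as Fin using (_≟_; any?; toℕ-injective)
open import Data.Fin.Relation.Unary.Top
  using (View; view; ‵fromℕ; ‵inj₁; ‵inject₁; view-fromℕ; view-inject₁)
open import Data.Fin.Subset using (Subset; _∈_; _∉_; ∣_∣; ⁅_⁆; ⊤; _∩_; _∪_; Nonempty)
open import Data.Fin.Subset.Properties
  using (_∈?_; ∈⊤; ∣⊤∣≡n; x∈⁅x⁆; x∈⁅y⁆⇒x≡y; x∈⁅y⁆⇔x≡y; ∣⁅x⁆∣≡1; ⊆-antisym;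
         x∈p∩q⁺; x∈p∩q⁻; x∈p∪q⁺; x∈p∪q⁻; x∈p∧x≢y⇒x∈p-y; x∈p⇒∣p-x∣<∣p∣)
open import Data.List.Base using ([]; _∷_; _++_; [_]; length; last)
open import Data.List.Membership.DecPropositional using () renaming (_∈?_ to mem?)
open import Data.List.Membership.Propositional using () renaming (_∈_ to _∈ₗ_)
open import Data.List.Properties using (length-tabulate)
open import Data.List.Relation.Unary.All as All using (All; []; _∷_)
import Data.List.Relation.Unary.All.Properties as All
open import Data.List.Relation.Unary.AllPairs using ([]; _∷_)
open import Data.List.Relation.Unary.Any using (here; there)
open import Data.List.Relation.Unary.Linked as Linked using (Linked; [-]; _∷_)
import Data.List.Relation.Unary.Linked.Properties as Linked
open import Data.List.Relation.Unary.Unique.Propositional using (Unique)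
import Data.List.Relation.Unary.Unique.Propositional.Properties as Unique
open import Data.Maybe.Base using (just)
open import Data.Maybe.Relation.Binary.Connected using (Connected; just)
open import Data.Nat.Base using (ℕ; zero; suc; _+_; _≤_; _<_; _∸_; z≤n; s≤s)
import Data.Nat.Properties as ℕ
open import Data.Product.Base using (Σ-syntax; ∃-syntax; _×_; _,_; proj₁; proj₂)
open import Data.Sum.Base as Sum using (_⊎_; inj₁; inj₂)
open import Data.Unit.Base using (tt)
open import Data.Vec.Base using (tabulate)
open import Data.Vec.Properties using (lookup∘tabulate; []=⇒lookup; lookup⇒[]=)
open import Function.Base using (_∘_; id)
open import Function.Bundles using (_⇔_; mk⇔; Equivalence)
open import Relation.Binary.Construct.Closure.ReflexiveTransitive as Star
  using (Star; ε; _◅_; _◅◅_)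
open import Relation.Binary.PropositionalEquality
  using (_≡_; _≢_; refl; sym; trans; cong; subst; ≢-sym)
open import Relation.Nullary using (¬_; Dec; yes; no; does; contradiction; ¬?; _×-dec_)

-- Cardinality bounds and simple paths.

module _ {m : ℕ} where

  ∈-tabulate⁺ : ∀ {f : Fin m → Bool} {i} → T (f i) → i ∈ tabulate f
  ∈-tabulate⁺ {f} {i} t =
    lookup⇒[]= i _ (trans (lookup∘tabulate f i) (Equivalence.to T-≡ t))

  ∈-tabulate⁻ : ∀ {f : Fin m → Bool} {i} → i ∈ tabulate f → T (f i)
  ∈-tabulate⁻ {f} {i} p =
    Equivalence.from T-≡ (trans (sym (lookup∘tabulate f i)) ([]=⇒lookup p))

  -- Deleting the head from `p` lowers its size and, by distinctness, keeps the tail inside. With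
  -- `p` the set of leaves this bounds the leaf count from below; with `⊤` it bounds the length of a
  -- simple path.
  unique⇒length≤ : ∀ {xs} {p : Subset m} → Unique xs → All (_∈ p) xs → length xs ≤ ∣ p ∣
  unique⇒length≤ []         []         = z≤n
  unique⇒length≤ (x∉ ∷ uxs) (x∈ ∷ xs∈) = ℕ.≤-trans
    (s≤s (unique⇒length≤ uxs
      (All.zipWith (λ (∈p , x≢) → x∈p∧x≢y⇒x∈p-y ∈p (≢-sym x≢)) (xs∈ , x∉))))
    (x∈p⇒∣p-x∣<∣p∣ x∈)

  module _ {R : Fin m → Fin m → Set} where

    SimplePath : Fin m → Fin m → Set
    SimplePath x y = ∃[ xs ] Unique (x ∷ xs) × Linked R (x ∷ xs) × last (x ∷ xs) ≡ just y

    suffix : ∀ {x y z xs} → x ∈ₗ z ∷ xs → Unique (z ∷ xs) → Linked R (z ∷ xs) →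
             last (z ∷ xs) ≡ just y → SimplePath x y
    suffix              (here refl)  u       l       e = _ , u , l , e
    suffix {xs = _ ∷ _} (there x∈xs) (_ ∷ u) (_ ∷ l) e = suffix x∈xs u l e

    -- If the new first vertex already lies on the simple path found for the rest, the loop is
    -- discarded by keeping only the suffix from that occurrence.
    loopErase : ∀ {x y} → Star R x y → SimplePath x y
    loopErase ε = [] , ([] ∷ []) , [-] , refl
    loopErase {x} (r ◅ rs) with loopErase rs
    ... | ws , u , l , e with mem? _≟_ x (_ ∷ ws)
    ...   | yes x∈ = suffix x∈ u l e
    ...   | no  x∉ = _ , All.¬Any⇒All¬ _ x∉ ∷ u , r ∷ l , e

-- Walks, bridges and leaves in a tree.

module _ (H : Tree) where
  open Tree H

  -- A step in the tree with one edge deleted; the edge is excluded in both directions so that walks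
  -- can be reversed.
  OffEdge : (s t a b : Vertex) → Set
  OffEdge s t a b = Adj a b × ¬ (a ≡ s × b ≡ t) × ¬ (a ≡ t × b ≡ s)

  OffVertex : (s a b : Vertex) → Set
  OffVertex s a b = Adj a b × a ≢ s × b ≢ s

  adj-sym : ∀ {a b} → Adj a b → Adj b a
  adj-sym = Graph.symmetric graph _ _

  adj⇒≢ : ∀ {a b} → Adj a b → a ≢ b
  adj⇒≢ ab refl = Graph.irreflexive graph _ ab

  reverseOff : ∀ {s t x y} → Star (OffEdge s t) x y → Star (OffEdge s t) y x
  reverseOff = Star.reverse λ (ab , p , q) →
    adj-sym ab , (λ (x , y) → q (y , x)) , (λ (x , y) → p (y , x))

  offSource : ∀ {s t x y} → Star (OffVertex s) x y → Star (OffEdge s t) x y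
  offSource = Star.map λ (ab , a≢ , b≢) → ab , (λ (e , _) → a≢ e) , (λ (_ , e) → b≢ e)

  offTarget : ∀ {s t x y} → Star (OffVertex t) x y → Star (OffEdge s t) x y
  offTarget = Star.map λ (ab , a≢ , b≢) → ab , (λ (_ , e) → b≢ e) , (λ (e , _) → a≢ e)

  -- After loop erasure, a path of length zero would make `st` a loop, a path of length one is the
  -- deleted edge itself, and a longer one is closed to a cycle by `st`.
  bridge : ∀ {s t} → Adj s t → ¬ Star (OffEdge s t) s t
  bridge {s} {t} st w with loopErase w
  ... | []         , _ , _                , refl = adj⇒≢ st refl
  ... | _ ∷ []     , _ , (_ , p , _) ∷ _ , refl = p (refl , refl)
  ... | x ∷ y ∷ xs , u , l               , e    = acyclic s (x ∷ y ∷ xs)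
    ( s≤s (s≤s z≤n) , u
    , Linked.++⁺ (Linked.map proj₁ l)
        (subst (λ z → Connected Adj z (just s)) (sym e) (just (adj-sym st))) [-])

  along : ∀ {x y z xs} → Linked Adj (y ∷ xs) → All (x ≢_) (y ∷ xs) → z ∈ₗ y ∷ xs →
          Star (OffVertex x) y z
  along l        x≢             (here refl) = ε
  along (yw ∷ l) (x≢y ∷ x≢w ∷ x≢) (there z∈) =
    (yw , ≢-sym x≢y , ≢-sym x≢w) ◅ along l (x≢w ∷ x≢) z∈

  -- If `z` lay on the path from `y` on, following the path from `y` to `z` and then stepping to `x`
  -- would join the ends of the edge `xy` without using it.
  nonBacktracking⇒fresh : ∀ {x y z xs} → Unique (x ∷ y ∷ xs) → Linked Adj (x ∷ y ∷ xs) →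
                          Adj x z → z ≢ y → All (z ≢_) (x ∷ y ∷ xs)
  nonBacktracking⇒fresh {x} {y} {z} (x≢ ∷ _) (xy ∷ l) xz z≢y = ≢-sym (adj⇒≢ xz) ∷
    All.¬Any⇒All¬ _ λ z∈ → bridge xy (reverseOff
      (offSource (along l x≢ z∈) ◅◅
        (adj-sym xz , (λ (e , _) → adj⇒≢ xz (sym e)) , (λ (e , _) → z≢y e)) ◅ ε))

  onlyNeighbour⇒leaf : ∀ {x y} → Adj x y → (∀ z → Adj x z → z ≡ y) → x ∈ leaves
  onlyNeighbour⇒leaf {x} {y} xy only = ∈-tabulate⁺ (ℕ.≡⇒≡ᵇ _ 1 (trans
    (cong ∣_∣ (⊆-antisym
      (λ z∈ → subst (_∈ ⁅ y ⁆) (sym (only _ (∈-tabulate⁻ z∈))) (x∈⁅x⁆ y))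
      (λ z∈ → subst (_∈ tabulate (adj x)) (sym (x∈⁅y⁆⇒x≡y y z∈)) (∈-tabulate⁺ xy))))
    (∣⁅x⁆∣≡1 y)))

  -- The path is stored backwards, its growing end `x` first. A neighbour of `x` other than `y` is
  -- always new, and if there is none then `x` is a leaf. The `fuel` cannot run out, since a simple
  -- path has at most `order` vertices. As `s` is already on the path behind `x`, the continuation
  -- avoids it.
  extendToLeaf : ∀ fuel {s x y xs} → order < fuel + length (x ∷ y ∷ xs) →
                 Unique (x ∷ y ∷ xs) → Linked Adj (x ∷ y ∷ xs) → s ∈ₗ y ∷ xs →
                 ∃[ ℓ ] ℓ ∈ leaves × Star (OffVertex s) x ℓ
  extendToLeaf zero m< u l s∈ = contradiction m< (ℕ.≤⇒≯ (ℕ.≤-trans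
    (unique⇒length≤ u (All.tabulate λ _ → ∈⊤)) (ℕ.≤-reflexive (∣⊤∣≡n order))))
  extendToLeaf (suc fuel) {s} {x} {y} {xs} m< u@(x≢ ∷ _) l@(xy ∷ _) s∈
    with any? (λ z → T? (adj x z) ×-dec ¬? (z ≟ y))
  ... | no ¬ext = x , onlyNeighbour⇒leaf xy only , ε
    where
    only : ∀ z → Adj x z → z ≡ y
    only z xz with z ≟ y
    ... | yes e = e
    ... | no  n = contradiction (z , xz , n) ¬ext
  ... | yes (z , xz , z≢y) =
    let fresh       = nonBacktracking⇒fresh u l xz z≢y
        ℓ , ℓ∈ , zℓ = extendToLeaf fuel (subst (order <_) (sym (ℕ.+-suc fuel _)) m<)
                        (fresh ∷ u) (adj-sym xz ∷ l) (there s∈)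
    in ℓ , ℓ∈ , (xz , All.lookup x≢ s∈ , All.lookup fresh (there s∈)) ◅ zℓ

  leafBeyond : ∀ {s t} → Adj s t → ∃[ ℓ ] ℓ ∈ leaves × Star (OffVertex s) t ℓ
  leafBeyond st = extendToLeaf order (ℕ.m<m+n order (s≤s z≤n))
    ((≢-sym (adj⇒≢ st) ∷ []) ∷ [] ∷ []) (adj-sym st ∷ [-]) (here refl)

  2≤leafCount : ∀ {x y : Vertex} → x ≢ y → 2 ≤ leafCount
  2≤leafCount {x} {y} x≢y with connected x y
  ... | ε      = contradiction refl x≢y
  ... | st ◅ _ with leafBeyond st | leafBeyond (adj-sym st)
  ...   | ℓ , ℓ∈ , tℓ | ℓ′ , ℓ′∈ , sℓ′ = unique⇒length≤ ((ℓ≢ℓ′ ∷ []) ∷ [] ∷ []) (ℓ∈ ∷ ℓ′∈ ∷ [])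
    where
    ℓ≢ℓ′ : ℓ ≢ ℓ′
    -- The walk from `s` avoids `t` and the walk from `t` avoids `s`; joined at a common leaf they
    -- would bypass the edge.
    ℓ≢ℓ′ refl = bridge st (offTarget sℓ′ ◅◅ reverseOff (offSource tℓ))

  -- The walk is cut at its first arrival at `t`, so everything before that step avoids `t`.
  lastStep : ∀ {c t} → c ≢ t → Star Adj c t → ∃[ s ] Adj s t × Star (OffVertex t) c s
  lastStep c≢t ε = contradiction refl c≢t
  lastStep {t = t} c≢t (_◅_ {j = b} cb bt) with b ≟ t
  ... | yes refl = _ , cb , ε
  ... | no  b≢t  = let s , st , bs = lastStep b≢t bt in s , st , (cb , c≢t , b≢t) ◅ bs

  insideSubtree : (S : Subtree H) → ∀ {t x y} → t ∉ Subtree.vertices S →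
                  x ∈ Subtree.vertices S → y ∈ Subtree.vertices S → Star (OffVertex t) x y
  insideSubtree S t∉ x∈ y∈ = Star.map
    (λ e → subgraph _ _ e , (λ { refl → t∉ (proj₁ (ends _ _ e)) })
                          , (λ { refl → t∉ (proj₂ (ends _ _ e)) }))
    (connected′ _ _ x∈ y∈)
    where open Subtree S using (subgraph; ends) renaming (connected to connected′)

  star≤leafCount : ∀ {k} (c : Vertex) (t : Fin k → Vertex) (S : Fin k → Subtree H) →
                   (∀ i → c ≢ t i) → (∀ i → c ∈ Subtree.vertices (S i)) →
                   (∀ i → t i ∈ Subtree.vertices (S i)) →
                   (∀ {i j} → i ≢ j → t j ∉ Subtree.vertices (S i)) → k ≤ leafCount
  star≤leafCount {k} c t S c≢t c∈S t∈S t∉S =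
    subst (_≤ leafCount) (length-tabulate ℓ)
      (unique⇒length≤ (Unique.tabulate⁺ ℓ-injective) (All.tabulate⁺ ℓ∈leaves))
    where
    module _ (i : Fin k) where
      before = lastStep (c≢t i) (connected c (t i))
      s   = proj₁ before
      s~t = proj₁ (proj₂ before)
      c⇝s = proj₂ (proj₂ before)
      beyond = leafBeyond s~t
      ℓ        = proj₁ beyond
      ℓ∈leaves = proj₁ (proj₂ beyond)
      t⇝ℓ      = proj₂ (proj₂ beyond)

    Off : Fin k → Vertex → Vertex → Set
    Off i = OffEdge (s i) (t i)

    -- The walk from `c` to `s i` avoids `t i`, so reaching `t i` off the edge would reconnect the
    -- two ends of a bridge.
    cut : ∀ i → ¬ Star (Off i) c (t i)
    cut i c⇝t = bridge (s~t i) (reverseOff (offTarget (c⇝s i)) ◅◅ c⇝t)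

    near : ∀ {i j} → i ≢ j → Star (Off i) c (t j)
    near {i} {j} i≢j = offTarget (insideSubtree (S j) (t∉S (≢-sym i≢j)) (c∈S j) (t∈S j))

    -- By `near`, the vertex `t j` is on the side of `c`; reaching it from `t i` off the edge would
    -- contradict `cut i`.
    far : ∀ {i j} → i ≢ j → ∀ {a} → Star (Off i) (t i) a → a ≢ t j
    far {i} i≢j ta refl = cut i (near i≢j ◅◅ reverseOff ta)

    -- A walk staying beyond the edge s i - t i misses t j, which lies on the side of c.
    transfer : ∀ {i j} → i ≢ j → ∀ {a b} → Star (Off i) (t i) a → Star (OffVertex (s i)) a b →
               Star (OffVertex (t j)) a b
    transfer i≢j ta ε = ε
    transfer i≢j ta (ab ◅ bs) =
      let tb = ta ◅◅ offSource (ab ◅ ε)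
      in (proj₁ ab , far i≢j ta , far i≢j tb) ◅ transfer i≢j tb bs

    ℓ-injective : ∀ {i j} → ℓ i ≡ ℓ j → i ≡ j
    ℓ-injective {i} {j} e with i ≟ j
    ... | yes i≡j = i≡j
    -- From `c` to `t i` inside `S i`, on to the common leaf, and back to `t j`: a walk that never
    -- uses the edge between `s j` and `t j`.
    ... | no  i≢j = contradiction
      (near (≢-sym i≢j) ◅◅ offTarget (transfer i≢j ε (t⇝ℓ i))
        ◅◅ reverseOff (offSource (subst (Star _ _) (sym e) (t⇝ℓ j))))
      (cut j)

-- Subtrees induced by vertex sets.

does⁺ : ∀ {P : Set} (P? : Dec P) → P → T (does P?)
does⁺ (yes _) _ = tt
does⁺ (no ¬p) p = contradiction p ¬p

does⁻ : ∀ {P : Set} (P? : Dec P) → T (does P?) → P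
does⁻ (yes p) _ = p

module _ (H : Tree) where
  open Tree H

  Within : Subset order → Vertex → Vertex → Set
  Within p a b = Adj a b × a ∈ p × b ∈ p

  induced : (p : Subset order) → Nonempty p →
            (∀ x y → x ∈ p → y ∈ p → Star (Within p) x y) → Subtree H
  induced p p≢∅ conn = record
    { vertices  = p
    ; edges     = λ x y → does (within? x y)
    ; symmetric = λ x y e → let xy , x∈ , y∈ = does⁻ (within? x y) e in
                            does⁺ (within? y x) (adj-sym H xy , y∈ , x∈)
    ; ends      = λ x y e → proj₂ (does⁻ (within? x y) e)
    ; subgraph  = λ x y e → proj₁ (does⁻ (within? x y) e)
    ; nonempty  = p≢∅
    ; connected = λ x y x∈ y∈ → Star.map (does⁺ (within? _ _)) (conn x y x∈ y∈)
    }
    where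
    within? : ∀ x y → Dec (Within p x y)
    within? x y = T? (adj x y) ×-dec (x ∈? p ×-dec y ∈? p)

  point : Vertex → Subtree H
  point x = induced ⁅ x ⁆ (x , x∈⁅x⁆ x) λ a b a∈ b∈ →
    subst (Star _ a) (trans (x∈⁅y⁆⇒x≡y x a∈) (sym (x∈⁅y⁆⇒x≡y x b∈))) ε

  whole : Vertex → Subtree H
  whole x = induced ⊤ (x , ∈⊤) λ a b _ _ → Star.map (λ ab → ab , ∈⊤ , ∈⊤) (connected a b)

  segment : ∀ {x y} → Adj x y → Subtree H
  segment {x} {y} xy = induced p (x , x∈) conn
    where
    p : Subset order
    p = ⁅ x ⁆ ∪ ⁅ y ⁆

    x∈ : x ∈ p
    x∈ = x∈p∪q⁺ (inj₁ (x∈⁅x⁆ x))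

    y∈ : y ∈ p
    y∈ = x∈p∪q⁺ (inj₂ (x∈⁅x⁆ y))

    conn : ∀ a b → a ∈ p → b ∈ p → Star (Within p) a b
    conn a b a∈ b∈ with x∈p∪q⁻ ⁅ x ⁆ ⁅ y ⁆ a∈ | x∈p∪q⁻ ⁅ x ⁆ ⁅ y ⁆ b∈
    ... | inj₁ a≡x | inj₁ b≡x rewrite x∈⁅y⁆⇒x≡y x a≡x | x∈⁅y⁆⇒x≡y x b≡x = ε
    ... | inj₁ a≡x | inj₂ b≡y rewrite x∈⁅y⁆⇒x≡y x a≡x | x∈⁅y⁆⇒x≡y y b≡y = (xy , x∈ , y∈) ◅ ε
    ... | inj₂ a≡y | inj₁ b≡x rewrite x∈⁅y⁆⇒x≡y y a≡y | x∈⁅y⁆⇒x≡y x b≡x =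
      (adj-sym H xy , y∈ , x∈) ◅ ε
    ... | inj₂ a≡y | inj₂ b≡y rewrite x∈⁅y⁆⇒x≡y y a≡y | x∈⁅y⁆⇒x≡y y b≡y = ε

meets-point : ∀ {m x} {p : Subset m} → Nonempty (p ∩ ⁅ x ⁆) ⇔ x ∈ p
meets-point {x = x} {p} = mk⇔
  (λ (z , z∈) → let z∈p , z∈x = x∈p∩q⁻ p ⁅ x ⁆ z∈ in subst (_∈ p) (x∈⁅y⁆⇒x≡y x z∈x) z∈p)
  (λ x∈p → x , x∈p∩q⁺ (x∈p , x∈⁅x⁆ x))

-- Stars as host trees.

∣const-false∣ : ∀ n → ∣ tabulate {n = n} (λ _ → false) ∣ ≡ 0
∣const-false∣ zero    = refl
∣const-false∣ (suc n) = ∣const-false∣ n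

∣const-true∣ : ∀ n → ∣ tabulate {n = n} (λ _ → true) ∣ ≡ n
∣const-true∣ zero    = refl
∣const-true∣ (suc n) = cong suc (∣const-true∣ n)

module _ (k : ℕ) where

  starGraph : Graph (suc k)
  starGraph = record
    { adj         = λ { zero (suc _) → true ; (suc _) zero → true ; _ _ → false }
    ; symmetric   = λ { zero (suc _) _ → tt ; (suc _) zero _ → tt }
    ; irreflexive = λ { zero () ; (suc _) () }
    }

  starTree : Tree
  starTree = record
    { order     = suc k
    ; nonempty  = _
    ; graph     = starGraph
    ; connected = λ u v → Star.reverse (λ {i} {j} → Graph.symmetric starGraph i j) (fromCentre u)
                          ◅◅ fromCentre v
    ; acyclic   = acyclic
    }
    where
    fromCentre : ∀ v → Star (Graph.Adj starGraph) zero v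
    fromCentre zero    = ε
    fromCentre (suc _) = tt ◅ ε

    acyclic : Graph.Acyclic starGraph
    -- Walks alternate between the centre and outer vertices, so a list of at least three vertices
    -- either repeats the centre or fails adjacency at some step, possibly the closing one.
    acyclic zero    (suc _ ∷ zero ∷ _)         (_ , (_ ∷ p ∷ _) ∷ _ , _) = p refl
    acyclic zero    (suc _ ∷ suc _ ∷ _)        (_ , _ , _ ∷ () ∷ _)
    acyclic zero    (zero ∷ _)                 (_ , _ , () ∷ _)
    acyclic (suc _) (suc _ ∷ _)                (_ , _ , () ∷ _)
    acyclic (suc _) (zero ∷ zero ∷ _)          (_ , _ , _ ∷ () ∷ _)
    acyclic (suc _) (zero ∷ suc _ ∷ zero ∷ _)  (_ , _ ∷ (_ ∷ p ∷ _) ∷ _ , _) = p refl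
    acyclic (suc _) (zero ∷ suc _ ∷ suc _ ∷ _) (_ , _ , _ ∷ _ ∷ () ∷ _)
    acyclic (suc _) (zero ∷ suc _ ∷ [])        (_ , _ , _ ∷ _ ∷ () ∷ _)
    acyclic _       (_ ∷ [])                   (s≤s () , _)

-- With at least two outer vertices the centre has degree at least 2, so exactly the outer vertices
-- are leaves.
starTree-leafCount : ∀ k → Tree.leafCount (starTree (2 + k)) ≡ 2 + k
starTree-leafCount k
  rewrite ∣const-false∣ k | ∣const-true∣ k = refl

-- Paths as host trees.

-- A closed walk without backtracking that starts along R follows R throughout,
-- provided R-steps can only be continued by R-steps or reversed.
module _ {A : Set} {Adj R _≺_ : A → A → Set}
         (continue : ∀ {a b c} → R a b → Adj b c → c ≢ a → R b c)
         (R⇒≺ : ∀ {a b} → R a b → a ≺ b)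
         (≺-trans : ∀ {a b c} → a ≺ b → b ≺ c → a ≺ c) where

  march : ∀ {x a b} xs → R a b → Unique (a ∷ b ∷ xs) → All (x ≢_) (a ∷ b ∷ xs) →
          Linked Adj (b ∷ xs ++ [ x ]) → b ≺ x
  march []       ab _                   (x≢a ∷ _) (bx ∷ _) = R⇒≺ (continue ab bx x≢a)
  march (c ∷ xs) ab ((_ ∷ a≢c ∷ _) ∷ u) (_ ∷ x≢)  (bc ∷ l) =
    let bc′ = continue ab bc (≢-sym a≢c) in ≺-trans (R⇒≺ bc′) (march xs bc′ u x≢ l)

  roundTrip : ∀ {x a b} xs → R x a → Unique (x ∷ a ∷ b ∷ xs) →
              Linked Adj (a ∷ b ∷ xs ++ [ x ]) → x ≺ x
  roundTrip xs xa (x≢@(_ ∷ x≢b ∷ _) ∷ u) (ab ∷ l) =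
    let ab′ = continue xa ab (≢-sym x≢b)
    in ≺-trans (R⇒≺ xa) (≺-trans (R⇒≺ ab′) (march xs ab′ u x≢ l))

module _ (k : ℕ) where

  Up : Fin k → Fin k → Set
  Up i j = suc (toℕ i) ≡ toℕ j

  pathGraph : Graph k
  pathGraph = record
    { adj         = λ i j → up? i j ∨ up? j i
    ; symmetric   = λ i j → Equivalence.from (T-∨ {up? j i})
        ∘ Sum.swap ∘ Equivalence.to (T-∨ {up? i j})
    ; irreflexive = λ i → Sum.[ (λ e → ℕ.1+n≢n (ℕ.≡ᵇ⇒≡ _ (toℕ i) e))
                              , (λ e → ℕ.1+n≢n (ℕ.≡ᵇ⇒≡ _ (toℕ i) e)) ] ∘ Equivalence.to (T-∨ {up? i i})
    }
    where
    up? : Fin k → Fin k → Bool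
    up? i j = does (suc (toℕ i) ℕ.≟ toℕ j)

  open Graph pathGraph

  upOrDown : ∀ {i j} → Adj i j → Up i j ⊎ Up j i
  upOrDown {i} {j} = Sum.map (ℕ.≡ᵇ⇒≡ _ (toℕ j)) (ℕ.≡ᵇ⇒≡ _ (toℕ i)) ∘ Equivalence.to T-∨

  -- A vertex has at most one lower neighbour, so a downward step from `b` would return to `a`.
  up-continue : ∀ {a b c} → Up a b → Adj b c → c ≢ a → Up b c
  up-continue ab bc c≢a with upOrDown bc
  ... | inj₁ b⇧c = b⇧c
  ... | inj₂ c⇧b = contradiction (toℕ-injective (ℕ.suc-injective (trans c⇧b (sym ab)))) c≢a

  down-continue : ∀ {a b c} → Up b a → Adj b c → c ≢ a → Up c b
  down-continue ba bc c≢a with upOrDown bc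
  ... | inj₁ b⇧c = contradiction (toℕ-injective (trans (sym b⇧c) ba)) c≢a
  ... | inj₂ c⇧b = c⇧b

  -- The first step fixes a direction which cannot change without backtracking. Labels are then
  -- strictly monotone round the cycle, and `x` would be strictly below itself.
  pathAcyclic : Acyclic
  pathAcyclic x (_ ∷ [])     (s≤s () , _)
  pathAcyclic x (a ∷ b ∷ xs) (_ , u , xa ∷ l) with upOrDown xa
  ... | inj₁ x⇧a = ℕ.<-irrefl {toℕ x} refl
    (roundTrip {Adj = Adj} up-continue ℕ.≤-reflexive ℕ.<-trans xs x⇧a u l)
  ... | inj₂ a⇧x = ℕ.<-irrefl {toℕ x} refl
    (roundTrip {Adj = Adj} {_≺_ = λ i j → toℕ j < toℕ i} down-continue
      ℕ.≤-reflexive (λ p q → ℕ.<-trans q p) xs a⇧x u l)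

path-fromZero : ∀ {k} (v : Fin (suc k)) → Star (Graph.Adj (pathGraph (suc k))) zero v
path-fromZero         zero    = ε
-- Adjacency compares labels, so shifting both ends by one leaves it definitionally unchanged; hence
-- `id`.
path-fromZero {suc k} (suc v) = tt ◅ Star.gmap suc id (path-fromZero v)

pathTree : ℕ → Tree
pathTree k = record
  { order     = suc k
  ; nonempty  = _
  ; graph     = pathGraph (suc k)
  ; connected = λ u v →
      Star.reverse (λ {i} {j} → Graph.symmetric (pathGraph (suc k)) i j) (path-fromZero u)
      ◅◅ path-fromZero v
  ; acyclic   = pathAcyclic (suc k)
  }

pathTree-leafCount : ∀ k → Tree.leafCount (pathTree (suc k)) ≡ 2
pathTree-leafCount k rewrite ∣const-false∣ k = cong suc (upperLeaf k)
  where
  -- In a longer path vertex 1 has two neighbours and is no leaf. From vertex 2 on, deleting vertex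
  -- 0 changes no degree, and this holds by computation.
  upperLeaf : ∀ k → ∣ tabulate (λ (i : Fin (suc k)) →
              does (Graph.degree (pathGraph (2 + k)) (suc i) ℕ.≟ 1)) ∣ ≡ 1
  upperLeaf zero    = refl
  upperLeaf (suc k) = upperLeaf k

-- Representations of `F` in a path and in a star.

module _ (k : ℕ) where

  private
    H = pathTree k
    open Subtree using (vertices)

  pathSubtree : ∀ {v : Fin (2 + k)} → View v → Subtree H
  pathSubtree (‵inject₁ i) = point H i
  pathSubtree ‵fromℕ       = whole H zero

  pathRepresentation : Representation (F (2 + k)) H
  pathRepresentation = record
    { source = λ v → pathSubtree (view v)
    ; sink   = λ v → pathSubtree (view v)
    ; edge⇔  = λ u v → meet (view u) (view v)
    }
    where
    meet : ∀ {u v : Fin (2 + k)} (p : View u) (q : View v) →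
           T (block p q) ⇔ Nonempty (vertices (pathSubtree p) ∩ vertices (pathSubtree q))
    meet (‵inject₁ i) (‵inject₁ j) = mk⇔
      (λ e → Equivalence.from meets-point
        (subst (_∈ ⁅ i ⁆) (does⁻ (i ≟ j) e) (x∈⁅x⁆ i)))
      (λ e → does⁺ (i ≟ j) (sym (x∈⁅y⁆⇒x≡y i (Equivalence.to meets-point e))))
    meet (‵inject₁ i) ‵fromℕ = mk⇔ (λ _ → i , x∈p∩q⁺ (x∈⁅x⁆ i , ∈⊤)) _
    meet ‵fromℕ (‵inject₁ j) = mk⇔ (λ _ → j , x∈p∩q⁺ (∈⊤ , x∈⁅x⁆ j)) _
    meet ‵fromℕ ‵fromℕ       = mk⇔ (λ _ → zero , x∈p∩q⁺ (∈⊤ {x = zero} , ∈⊤ {x = zero})) _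

module _ (k : ℕ) where

  private
    H = starTree k
    open Subtree using (vertices)

  -- Row `i` of the matrix has its ones at `i` and at the last vertex; the sinks of these two are
  -- placed at the ends of the segment.
  starSource : ∀ {v : Fin (suc k)} → View v → Subtree H
  starSource (‵inject₁ i) = segment H {zero} {suc i} tt
  starSource ‵fromℕ       = whole H zero

  starSink : ∀ {v : Fin (suc k)} → View v → Fin (suc k)
  starSink (‵inject₁ i) = suc i
  starSink ‵fromℕ       = zero

  starRepresentation : Representation (F (suc k)) H
  starRepresentation = record
    { source = λ v → starSource (view v)
    ; sink   = λ v → point H (starSink (view v))
    ; edge⇔  = λ u v → meet (view u) (view v)
    }
    where
    hits : ∀ {u v : Fin (suc k)} (p : View u) (q : View v) →
           T (block p q) ⇔ starSink q ∈ vertices (starSource p)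
    hits (‵inject₁ i) (‵inject₁ j) = mk⇔
      (λ e → x∈p∪q⁺ {p = ⁅ zero ⁆}
        (inj₂ (Equivalence.from x∈⁅y⁆⇔x≡y (cong suc (sym (does⁻ (i ≟ j) e))))))
      (λ j∈ → does⁺ (i ≟ j) (sym (inSegment (x∈p∪q⁻ ⁅ zero ⁆ ⁅ suc i ⁆ j∈))))
      where
      inSegment : suc j ∈ ⁅ zero ⁆ ⊎ suc j ∈ ⁅ suc i ⁆ → j ≡ i
      inSegment (inj₁ p) = contradiction (x∈⁅y⁆⇒x≡y zero p) λ ()
      inSegment (inj₂ p) = Fin.suc-injective (x∈⁅y⁆⇒x≡y (suc i) p)
    hits (‵inject₁ i) ‵fromℕ = mk⇔ (λ _ → x∈p∪q⁺ {q = ⁅ suc i ⁆} (inj₁ (x∈⁅x⁆ zero))) _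
    hits ‵fromℕ (‵inject₁ j) = mk⇔ (λ _ → ∈⊤) _
    hits ‵fromℕ ‵fromℕ       = mk⇔ (λ _ → ∈⊤) _

    meet : ∀ {u v : Fin (suc k)} (p : View u) (q : View v) →
           T (block p q) ⇔ Nonempty (vertices (starSource p) ∩ ⁅ starSink q ⁆)
    meet p q = mk⇔ (Equivalence.from meets-point ∘ Equivalence.to (hits p q))
                   (Equivalence.from (hits p q) ∘ Equivalence.to meets-point)

-- Leafage and catch leafage of `F`.

leafage-F : ∀ k → IsLeafage (F (3 + k)) 2
leafage-F k =
  (pathTree (suc k) , pathTree-leafCount k , pathRepresentation (suc k)) ,
  λ { _ (H , refl , R) →
      -- Vertices 0 and 1 form a non-edge, so the source of 0 is disjoint from the sink of 1 and the
      -- host has two distinct vertices.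
      let open Representation R
          x , x∈ = Subtree.nonempty (source zero)
          y , y∈ = Subtree.nonempty (sink (suc zero))
      in 2≤leafCount H {x} {y} λ x≡y →
           Equivalence.from (edge⇔ zero (suc zero))
             (x , x∈p∩q⁺ (x∈ , subst (_∈ Subtree.vertices (sink (suc zero))) (sym x≡y) y∈)) }

catchLeafage-F : ∀ k → IsCatchLeafage (F (3 + k)) (2 + k)
catchLeafage-F k =
  ( starTree (2 + k) , starTree-leafCount k , starRepresentation (2 + k)
  , λ v → starSink (2 + k) (view v) , refl ) ,
  λ { _ (H , refl , R , catch) → lower H R catch }
  where
  module _ (H : Tree) (R : Representation (F (3 + k)) H) (catch : IsCatch R) where
    open Representation R
    open Subtree using (vertices)

    at : Fin (3 + k) → Tree.Vertex H
    at v = proj₁ (catch v)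

    edge⇔∈ : ∀ u v → Edge (F (3 + k)) u v ⇔ at v ∈ vertices (source u)
    edge⇔∈ u v = mk⇔
      (λ e → Equivalence.to meets-point
        (subst (λ q → Nonempty (vertices (source u) ∩ q)) (proj₂ (catch v))
          (Equivalence.to (edge⇔ u v) e)))
      (λ v∈ → Equivalence.from (edge⇔ u v)
        (subst (λ q → Nonempty (vertices (source u) ∩ q)) (sym (proj₂ (catch v)))
          (Equivalence.from meets-point v∈)))

    c∈ : ∀ i → at (fromℕ _) ∈ vertices (source (inject₁ i))
    c∈ i = Equivalence.to (edge⇔∈ _ _) e
      where
      e : Edge (F (3 + k)) (inject₁ i) (fromℕ _)
      e rewrite view-inject₁ i | view-fromℕ (2 + k) = tt

    t∈ : ∀ i → at (inject₁ i) ∈ vertices (source (inject₁ i))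
    t∈ i = Equivalence.to (edge⇔∈ _ _) e
      where
      e : Edge (F (3 + k)) (inject₁ i) (inject₁ i)
      e rewrite view-inject₁ i = does⁺ (i ≟ i) refl

    t∉ : ∀ {i j} → i ≢ j → at (inject₁ j) ∉ vertices (source (inject₁ i))
    t∉ {i} {j} i≢j j∈ = ¬e (Equivalence.from (edge⇔∈ _ _) j∈)
      where
      ¬e : ¬ Edge (F (3 + k)) (inject₁ i) (inject₁ j)
      ¬e rewrite view-inject₁ i | view-inject₁ j = i≢j ∘ does⁻ (i ≟ j)

    another : (i : Fin (2 + k)) → ∃[ j ] j ≢ i
    another zero    = suc zero , λ ()
    another (suc _) = zero , λ ()

    lower : 2 + k ≤ Tree.leafCount H
    lower = star≤leafCount H (at (fromℕ _)) (at ∘ inject₁) (source ∘ inject₁)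
      -- The source of a second index `j` contains `c` but not `t i`, so the two differ; with a
      -- single index they could coincide.
      (λ i c≡t → let j , j≢i = another i in t∉ j≢i (subst (_∈ vertices (source (inject₁ j))) c≡t (c∈ j)))
      c∈ t∈ t∉

-- Ferrers partitions of the complement of `F`.

-- These are the entries of the complement above the diagonal. Its last row and column are empty,
-- hence the default `false`.
below : ∀ {n} {u v : Fin n} → View u → View v → Bool
below (‵inject₁ i) (‵inject₁ j) = does (i Fin.<? j)
below _            _            = false

below-asym : ∀ {n} {u v : Fin n} (p : View u) (q : View v) → T (below p q) → ¬ T (below q p)
below-asym (‵inject₁ i) (‵inject₁ j) i<j j<i =
  ℕ.<-asym (does⁻ (i Fin.<? j) i<j) (does⁻ (j Fin.<? i) j<i)

below-connex : ∀ {n} {u v : Fin n} (p : View u) (q : View v) →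
               T (not (block p q)) ⇔ (T (below p q) ⊎ T (below q p))
below-connex (‵inject₁ i) (‵inject₁ j) with i ≟ j
... | yes refl = mk⇔ (λ ()) Sum.[ irrefl , irrefl ]
  where
  irrefl : ¬ T (does (i Fin.<? i))
  irrefl i<i = ℕ.<-irrefl refl (does⁻ (i Fin.<? i) i<i)
... | no i≢j = mk⇔
  (λ _ → Sum.map (λ i≤j → does⁺ (i Fin.<? j) (Fin.≤∧≢⇒< i≤j i≢j))
                 (λ j≤i → does⁺ (j Fin.<? i) (Fin.≤∧≢⇒< j≤i (≢-sym i≢j)))
                 (Fin.≤-total i j))
  _
below-connex (‵inject₁ _) ‵fromℕ       = mk⇔ (λ ()) Sum.[ id , id ]
below-connex ‵fromℕ       (‵inject₁ _) = mk⇔ (λ ()) Sum.[ id , id ]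
below-connex ‵fromℕ       ‵fromℕ       = mk⇔ (λ ()) Sum.[ id , id ]

-- Successors are larger indices, so the successor set shrinks as the index grows. The inner views
-- are arbitrary because `below` reads only the indices.
below-≤ˡ : ∀ {n} {u : Fin (suc n)} {i j : Fin n} {p : View i} {q : View j} (r : View u) → i Fin.≤ j →
           T (below (‵inj₁ q) r) → T (below (‵inj₁ p) r)
below-≤ˡ {i = i} {j} (‵inject₁ l) i≤j j<l =
  does⁺ (i Fin.<? l) (ℕ.≤-<-trans i≤j (does⁻ (j Fin.<? l) j<l))

below-≤ʳ : ∀ {n} {u : Fin (suc n)} {i j : Fin n} {p : View i} {q : View j} (r : View u) → i Fin.≤ j →
           T (below r (‵inj₁ p)) → T (below r (‵inj₁ q))
below-≤ʳ {i = i} {j} (‵inject₁ l) i≤j l<i =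
  does⁺ (l Fin.<? j) (ℕ.<-≤-trans (does⁻ (l Fin.<? i) l<i) i≤j)

below-ferrers : ∀ {n} → Ferrers {n} (λ u v → below (view u) (view v))
below-ferrers u v = compare (view u) (view v)
  where
  compare : ∀ {u v} (p : View u) (q : View v) →
            (∀ {w} → T (below p (view w)) → T (below q (view w))) ⊎
            (∀ {w} → T (below q (view w)) → T (below p (view w)))
  compare ‵fromℕ q = inj₁ λ ()
  compare (‵inject₁ _) ‵fromℕ = inj₂ λ ()
  compare (‵inject₁ i) (‵inject₁ j) = Sum.map
    (λ j≤i {w} → below-≤ˡ (view w) j≤i)
    (λ i≤j {w} → below-≤ˡ (view w) i≤j) (Fin.≤-total j i)

-- Successor sets are now initial segments, growing with the index, and that of the last vertex is
-- empty.
above-ferrers : ∀ {n} → Ferrers {n} (λ u v → below (view v) (view u))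
above-ferrers u v = compare (view u) (view v)
  where
  empty : ∀ {m} {w : Fin (suc m)} (r : View w) → ¬ T (below r ‵fromℕ)
  empty (‵inject₁ _) ()
  empty ‵fromℕ       ()

  compare : ∀ {u v} (p : View u) (q : View v) →
            (∀ {w} → T (below (view w) p) → T (below (view w) q)) ⊎
            (∀ {w} → T (below (view w) q) → T (below (view w) p))
  compare ‵fromℕ q = inj₁ λ {w} e → contradiction e (empty (view w))
  compare (‵inject₁ _) ‵fromℕ = inj₂ λ {w} e → contradiction e (empty (view w))
  compare (‵inject₁ i) (‵inject₁ j) = Sum.map
    (λ i≤j {w} → below-≤ʳ (view w) i≤j) (λ j≤i {w} → below-≤ʳ (view w) j≤i) (Fin.≤-total i j)

fStar-F : ∀ k → IsFStar (F (3 + k)) 2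
fStar-F k = partition , lower
  where
  part : Fin 2 → Digraph (3 + k)
  part zero       u v = below (view u) (view v)
  part (suc zero) u v = below (view v) (view u)

  partition : FerrersPartition (complement (F (3 + k))) 2
  partition = record
    { part     = part
    ; ferrers  = λ { zero → below-ferrers ; (suc zero) → above-ferrers }
    ; disjoint = λ { zero       zero       i≢i _ _ _       → i≢i refl
                   ; zero       (suc zero) _   u v (p , q) → below-asym (view u) (view v) p q
                   ; (suc zero) zero       _   u v (p , q) → below-asym (view u) (view v) q p
                   ; (suc zero) (suc zero) i≢i _ _ _       → i≢i refl }
    ; union    = λ u v → mk⇔
        (λ e → Sum.[ (zero ,_) , (suc zero ,_) ]
                 (Equivalence.to (below-connex (view u) (view v)) e))
        (λ { (zero     , e) → Equivalence.from (below-connex (view u) (view v)) (inj₁ e)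
           ; (suc zero , e) → Equivalence.from (below-connex (view u) (view v)) (inj₂ e) })
    }

  -- Rows and columns 0 and 1 of the complement form a permutation matrix. A single part would
  -- contain (0,1) and (1,0), and nested successor sets would add (0,0) or (1,1), which the
  -- complement lacks.
  lower : ∀ j → FerrersPartition (complement (F (3 + k))) j → 2 ≤ j
  lower zero P with Equivalence.to (FerrersPartition.union P zero (suc zero)) tt
  ... | () , _
  lower (suc zero) P with Equivalence.to (FerrersPartition.union P zero (suc zero)) tt
                        | Equivalence.to (FerrersPartition.union P (suc zero) zero) tt
                        | FerrersPartition.ferrers P zero zero (suc zero)
  ... | zero , e₀₁ | zero , _   | inj₁ 0⊆1 =
    contradiction (Equivalence.from (FerrersPartition.union P (suc zero) (suc zero))
      (zero , 0⊆1 e₀₁)) λ ()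
  ... | zero , _   | zero , e₁₀ | inj₂ 1⊆0 =
    contradiction (Equivalence.from (FerrersPartition.union P zero zero)
      (zero , 1⊆0 e₁₀)) λ ()
  lower (suc (suc _)) _ = s≤s (s≤s z≤n)

theorem10 : (∀ (f : ℕ → ℕ) →
    ∃[ n ] Σ[ D ∈ Digraph n ] ∃[ a ] ∃[ b ]
    (IsLeafage D a × IsCatchLeafage D b × f a < b))
    ×
    (∀ (n : ℕ) → 3 ≤ n →
    IsFStar (F n) 2 × IsLeafage (F n) 2 × IsCatchLeafage (F n) (n ∸ 1))
theorem10 =
  -- The leafage is always 2, so only the value `f 2` has to be exceeded; `3 + f 2` vertices give
  -- catch leafage `2 + f 2`.
  (λ f → 3 + f 2 , F (3 + f 2) , 2 , 2 + f 2 ,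
         leafage-F (f 2) , catchLeafage-F (f 2) , ℕ.m≤n+m (suc (f 2)) 1) ,
  λ { (suc (suc (suc k))) (s≤s (s≤s (s≤s z≤n))) → fStar-F k , leafage-F k , catchLeafage-F k }
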